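{- Let $n\ge 3$ be an odd integer, $d,k\ge1$ integers, and $E\subset\mathbb{Z}_n^d$. Suppose that \[ |E| \gg \frac{\sqrt{\tau(n)}\, n^{d+\frac{k-1}{2}}}{\gamma(n)^{(d-1)/2}}. \] Then \[ \frac{1}{|E|^k}\sum_{y^1,\dots,y^k\in E} \left|\Delta_{y^1,\dots,y^k}(E)\right| \gg n^k. \]
   Context: For $x\in\mathbb{Z}_n^d$, $\|x\|=x_1^2+\dots+x_d^2\in\mathbb{Z}_n$. For $y^1,\dots,y^k\in\mathbb{Z}_n^d$, the $k$-star set is $\Delta_{y^1,\dots,y^k}(E)=\{(\|x-y^1\|,\dots,\|x-y^k\|)\in\mathbb{Z}_n^k : x\in E\}$. $\gamma(n)$ is the smallest prime divisor of $n$ and $\tau(n)$ the number of divisors of $n$. $X\gg Y$ means $X\ge CY$ for a constant $C>0$ independent of $n$ and $E$ (possibly depending on $d,k$); a hypothesis $|E|\gg Y$ means $|E|\ge CY$ for a suitable sufficiently large such constant. -}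

module Defs where

open import Data.Nat using (ℕ; zero; suc; _+_; _*_; _∸_; _^_; NonZero)
open import Data.Nat.DivMod using (_mod_)
open import Data.Nat.Divisibility using (_∣?_)
open import Data.Nat.Primality using (prime?)
open import Data.Fin using (Fin; toℕ)
open import Data.Fin.Properties using () renaming (_≟_ to _≟F_)
open import Data.Vec using (Vec; []; _∷_; zipWith; foldr; map)
open import Data.Vec.Properties using (≡-dec)
open import Data.List as L using (List; []; _∷_; filter; length; concatMap; allFin; upTo)
open import Data.Bool.ListAction using (any)
open import Data.Nat.ListAction using (sum)
open import Relation.Nullary.Decidable using (T?)
open import Data.Bool using (Bool; _∧_)
open import Relation.Nullary.Decidable using (⌊_⌋; _×-dec_)

Zn^ : ℕ → ℕ → Set
Zn^ n d = Vec (Fin n) d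

allVecsOf : {A : Set} → List A → (k : ℕ) → List (Vec A k)
allVecsOf xs zero = [] ∷ []
allVecsOf xs (suc k) = concatMap (λ a → L.map (a ∷_) (allVecsOf xs k)) xs

allZn : (n d : ℕ) → List (Zn^ n d)
allZn n d = allVecsOf (allFin n) d

sqDist : {n d : ℕ} .{{_ : NonZero n}} → Zn^ n d → Zn^ n d → Fin n
sqDist {n} x y =
  foldr (λ _ → ℕ) _+_ 0 (zipWith (λ a b → (toℕ a + (n ∸ toℕ b)) ^ 2) x y) mod n

Subset : ℕ → ℕ → Set
Subset n d = Zn^ n d → Bool

elems : {n d : ℕ} → Subset n d → List (Zn^ n d)
elems {n} {d} E = filter (λ x → T? (E x)) (allZn n d)

card : {n d : ℕ} → Subset n d → ℕ
card E = length (elems E)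

starTuple : {n d k : ℕ} .{{_ : NonZero n}} → Vec (Zn^ n d) k → Zn^ n d → Zn^ n k
starTuple ys x = map (λ y → sqDist x y) ys

starCard : {n d k : ℕ} .{{_ : NonZero n}} → Subset n d → Vec (Zn^ n d) k → ℕ
starCard {n} {d} {k} E ys =
  length (filter (λ t → T? (any (λ x → ⌊ ≡-dec _≟F_ (starTuple ys x) t ⌋) (elems E)))
                 (allZn n k))

starSum : {n d : ℕ} .{{_ : NonZero n}} → (k : ℕ) → Subset n d → ℕ
starSum k E = sum (L.map (starCard E) (allVecsOf (elems E) k))

τ : ℕ → ℕ
τ n = length (filter (λ m → m ∣? n) (L.map suc (upTo n)))

-- γ(n): smallest prime divisor of n (n ≥ 2); default n if none found
γ : ℕ → ℕ
γ n with filter (λ p → prime? p ×-dec p ∣? n) (upTo (suc n))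
... | [] = n
... | p ∷ _ = p

-- Write N = |E|, and for a tuple of apices ys let Q(ys) = Σ_t ν(t)², where ν(t) counts the x ∈ E whose
-- distance tuple to ys is t. Summing (2N − n^k ν(t))² ≥ 0 over the attained t bounds the size of the star set from
-- below as soon as Σ_{ys ∈ E^k} Q(ys) ≤ 2 N^{k+2} / n^k. This is shown by adding apices one at a time, without
-- characters. By Cauchy–Schwarz n Q(y, ys) − Q(ys) ≥ 0, so its sum over y ∈ E is at most its sum over all y. The
-- latter counts, for pairs x, x′ ∈ E, the solutions y of ‖x − y‖ = ‖x′ − y‖, a linear equation in y because
-- the quadratic terms cancel; since n is odd it has at most n^{d−1} gcd(n, x₁ − x′₁, …, x_d − x′_d) solutions. Finally
-- gcd ≤ 1 + Σ_{g ∣ n, g > 1} g [g ∣ x − x′], and the sum over x′ of the g-th term is n^d g^{1−d} ≤ n^d γ(n)^{1−d}.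
module Submission where

open import Defs
open import Data.Bool using (T; if_then_else_)
open import Data.Bool.ListAction using (any)
open import Data.Empty using (⊥-elim)
open import Data.Fin using (Fin; zero; suc; toℕ)
open import Data.Fin.Properties as Fin using () renaming (_≟_ to _≟F_)
open import Data.Integer as ℤ using (ℤ; +_; -[1+_]; ∣_∣)
open import Data.Integer.Divisibility.Signed as ℤ∣ using () renaming (_∣_ to _∣ᶻ_; _∣?_ to _∣ᶻ?_)
import Data.Integer.Properties as ℤ
open import Data.Integer.Tactic.RingSolver using () renaming (solve-∀ to ℤsolve-∀)
open import Data.List as L using (List; []; _∷_; _++_; length; filter; concatMap; allFin; upTo)
open import Data.List.Membership.Propositional using (_∈_)
open import Data.List.Membership.Propositional.Properties using (∈-filter⁺; ∈-filter⁻; ∈-map⁺; ∈-upTo⁺)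
import Data.List.Properties as L
open import Data.List.Relation.Unary.All as All using ()
open import Data.List.Relation.Unary.AllPairs as AllPairs using ()
import Data.List.Relation.Unary.AllPairs.Properties as AllPairs
open import Data.List.Relation.Unary.Any using (here; there)
open import Data.Nat using (ℕ; zero; suc; _+_; _*_; _∸_; _^_; _≤_; _<_; _%_; NonZero; ≢-nonZero; ≢-nonZero⁻¹; >-nonZero; >-nonZero⁻¹; z≤n; s≤s; s≤s⁻¹)
open import Data.Nat.Coprimality as Coprimality using (Coprime; coprime-divisor; coprime-/gcd)
open import Data.Nat.DivMod
open import Data.Nat.Divisibility as ℕ∣ using (_∣_; divides; divides-refl; _∣?_)
open import Data.Nat.GCD
import Data.Nat.ListAction
open import Data.Nat.Primality using (Prime; prime?)
open import Data.Nat.Primality.Factorisation using (factorise)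
open import Data.Nat.Properties
open import Data.Nat.Tactic.RingSolver using (solve-∀)
open import Data.Product using (Σ; _×_; _,_; proj₂)
open import Data.Sum using (_⊎_; inj₁; inj₂)
open import Data.Vec using (Vec; []; _∷_; foldr; zipWith)
open import Data.Vec.Properties using (≡-dec; ∷-injective)
open import Function using (_∘_; id)
open import Relation.Binary.PropositionalEquality using (_≡_; refl; sym; trans; cong; cong₂; subst; subst₂)
open import Relation.Nullary using (Dec; does; yes; no; ¬_)
open import Relation.Nullary.Decidable using (T?; ⌊_⌋; _×-dec_)
open import Relation.Unary using (Decidable)

private
  variable
    A B : Set
    P Q : Set
    n : ℕ

-- Finite sums and indicators

∑ : List A → (A → ℕ) → ℕ
∑ xs f = Data.Nat.ListAction.sum (L.map f xs)

syntax ∑ xs (λ x → e) = ∑[ x ∈ xs ] e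

infix 5 ∑

∑-cong : (xs : List A) {f g : A → ℕ} → (∀ x → f x ≡ g x) → ∑ xs f ≡ ∑ xs g
∑-cong []       f≡g = refl
∑-cong (x ∷ xs) f≡g = cong₂ _+_ (f≡g x) (∑-cong xs f≡g)

∑-mono : (xs : List A) {f g : A → ℕ} → (∀ x → f x ≤ g x) → ∑ xs f ≤ ∑ xs g
∑-mono []       f≤g = z≤n
∑-mono (x ∷ xs) f≤g = +-mono-≤ (f≤g x) (∑-mono xs f≤g)

∑-const : (xs : List A) (c : ℕ) → ∑ xs (λ _ → c) ≡ length xs * c
∑-const []       c = refl
∑-const (x ∷ xs) c = cong (_+_ c) (∑-const xs c)

∑-zero : (xs : List A) → ∑ xs (λ _ → 0) ≡ 0
∑-zero xs = trans (∑-const xs 0) (*-zeroʳ (length xs))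

∑-+ : (xs : List A) (f g : A → ℕ) → ∑ xs (λ x → f x + g x) ≡ ∑ xs f + ∑ xs g
∑-+ []       f g = refl
∑-+ (x ∷ xs) f g rewrite ∑-+ xs f g = lemma (f x) (g x) (∑ xs f) (∑ xs g)
  where
  lemma : ∀ a b c d → a + b + (c + d) ≡ a + c + (b + d)
  lemma = solve-∀

∑-*ˡ : (xs : List A) (c : ℕ) (f : A → ℕ) → ∑ xs (λ x → c * f x) ≡ c * ∑ xs f
∑-*ˡ []       c f = sym (*-zeroʳ c)
∑-*ˡ (x ∷ xs) c f rewrite ∑-*ˡ xs c f = sym (*-distribˡ-+ c (f x) (∑ xs f))

∑-*ʳ : (xs : List A) (c : ℕ) (f : A → ℕ) → ∑ xs (λ x → f x * c) ≡ ∑ xs f * c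
∑-*ʳ xs c f = trans (∑-cong xs λ x → *-comm (f x) c) (trans (∑-*ˡ xs c f) (*-comm c (∑ xs f)))

∑-++ : (xs ys : List A) (f : A → ℕ) → ∑ (xs ++ ys) f ≡ ∑ xs f + ∑ ys f
∑-++ []       ys f = refl
∑-++ (x ∷ xs) ys f rewrite ∑-++ xs ys f = sym (+-assoc (f x) (∑ xs f) (∑ ys f))

∑-map : (xs : List A) (g : A → B) (f : B → ℕ) → ∑ (L.map g xs) f ≡ ∑ xs (f ∘ g)
∑-map []       g f = refl
∑-map (x ∷ xs) g f = cong (_+_ (f (g x))) (∑-map xs g f)

∑-concatMap : (xs : List A) (g : A → List B) (f : B → ℕ) →
              ∑ (concatMap g xs) f ≡ ∑[ x ∈ xs ] ∑ (g x) f
∑-concatMap []       g f = refl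
∑-concatMap (x ∷ xs) g f = trans (∑-++ (g x) (concatMap g xs) f) (cong (_+_ (∑ (g x) f)) (∑-concatMap xs g f))

∑-swap : (xs : List A) (ys : List B) (f : A → B → ℕ) →
         (∑[ x ∈ xs ] ∑[ y ∈ ys ] f x y) ≡ (∑[ y ∈ ys ] ∑[ x ∈ xs ] f x y)
∑-swap []       ys f = sym (∑-zero ys)
∑-swap (x ∷ xs) ys f =
  trans (cong (_+_ (∑ ys (f x))) (∑-swap xs ys f)) (sym (∑-+ ys (f x) (λ y → ∑ xs (λ x → f x y))))

∑-*-∑ : (xs : List A) (ys : List B) (f : A → ℕ) (g : B → ℕ) →
        ∑ xs f * ∑ ys g ≡ (∑[ x ∈ xs ] ∑[ y ∈ ys ] f x * g y)
∑-*-∑ xs ys f g = trans (sym (∑-*ʳ xs (∑ ys g) f)) (∑-cong xs λ x → sym (∑-*ˡ ys (f x) g))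

∑-allVecsOf : (xs : List A) (k : ℕ) (f : Vec A (suc k) → ℕ) →
              ∑ (allVecsOf xs (suc k)) f ≡ (∑[ x ∈ xs ] ∑[ v ∈ allVecsOf xs k ] f (x ∷ v))
∑-allVecsOf xs k f = trans (∑-concatMap xs _ f) (∑-cong xs λ x → ∑-map (allVecsOf xs k) (x ∷_) f)

length-as-∑ : (xs : List A) → length xs ≡ ∑ xs (λ _ → 1)
length-as-∑ xs = trans (sym (*-identityʳ (length xs))) (sym (∑-const xs 1))

length-allVecsOf : (xs : List A) (k : ℕ) → length (allVecsOf xs k) ≡ length xs ^ k
length-allVecsOf xs zero    = refl
length-allVecsOf xs (suc k) =
  trans (length-as-∑ (allVecsOf xs (suc k)))
  (trans (∑-allVecsOf xs k (λ _ → 1))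
  (trans (∑-cong xs λ _ → trans (sym (length-as-∑ (allVecsOf xs k))) (length-allVecsOf xs k))
         (∑-const xs (length xs ^ k))))

length-allZn : ∀ n d → length (allZn n d) ≡ n ^ d
length-allZn n d = trans (length-allVecsOf (allFin n) d) (cong (_^ d) (L.length-tabulate {n = n} id))

𝟙 : Dec P → ℕ
𝟙 p = if does p then 1 else 0

𝟙-mono : (p : Dec P) (q : Dec Q) → (P → Q) → 𝟙 p ≤ 𝟙 q
𝟙-mono (no _)  q       _   = z≤n
𝟙-mono (yes _) (yes _) _   = ≤-refl
𝟙-mono (yes p) (no ¬q) P⇒Q = ⊥-elim (¬q (P⇒Q p))

𝟙-cong : (p : Dec P) (q : Dec Q) → (P → Q) → (Q → P) → 𝟙 p ≡ 𝟙 q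
𝟙-cong p q P⇒Q Q⇒P = ≤-antisym (𝟙-mono p q P⇒Q) (𝟙-mono q p Q⇒P)

𝟙-× : (p : Dec P) (q : Dec Q) → 𝟙 (p ×-dec q) ≡ 𝟙 p * 𝟙 q
𝟙-× (yes _) (yes _) = refl
𝟙-× (yes _) (no _)  = refl
𝟙-× (no _)  _       = refl

𝟙-yes : (p : Dec P) → P → 𝟙 p ≡ 1
𝟙-yes (yes _) _ = refl
𝟙-yes (no ¬p) p = ⊥-elim (¬p p)

𝟙-no : (p : Dec P) → ¬ P → 𝟙 p ≡ 0
𝟙-no (yes p) ¬p = ⊥-elim (¬p p)
𝟙-no (no _)  _  = refl

∑-filter : {R : A → Set} (R? : Decidable R) (xs : List A) (f : A → ℕ) →
           ∑ (filter R? xs) f ≡ (∑[ x ∈ xs ] 𝟙 (R? x) * f x)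
∑-filter R? []       f = refl
∑-filter R? (x ∷ xs) f with R? x
... | yes _ = cong₂ _+_ (sym (*-identityˡ (f x))) (∑-filter R? xs f)
... | no _  = ∑-filter R? xs f

∑-filter-≤ : {R : A → Set} (R? : Decidable R) (xs : List A) (f : A → ℕ) → ∑ (filter R? xs) f ≤ ∑ xs f
∑-filter-≤ R? []       f = z≤n
∑-filter-≤ R? (x ∷ xs) f with R? x
... | yes _ = +-monoʳ-≤ (f x) (∑-filter-≤ R? xs f)
... | no _  = ≤-trans (∑-filter-≤ R? xs f) (m≤n+m _ (f x))

length-filter-∑ : {R : A → Set} (R? : Decidable R) (xs : List A) → length (filter R? xs) ≡ (∑[ x ∈ xs ] 𝟙 (R? x))
length-filter-∑ R? xs =
  trans (length-as-∑ (filter R? xs)) (trans (∑-filter R? xs (λ _ → 1)) (∑-cong xs λ x → *-identityʳ (𝟙 (R? x))))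

∑-tabulate : (g : Fin n → A) (f : A → ℕ) → ∑ (L.tabulate g) f ≡ ∑ (allFin n) (f ∘ g)
∑-tabulate g f = cong Data.Nat.ListAction.sum
  (trans (L.map-tabulate g f) (sym (L.map-tabulate id (f ∘ g))))

∑-allFin-suc : ∀ n (f : Fin (suc n) → ℕ) → ∑ (allFin (suc n)) f ≡ f zero + ∑ (allFin n) (f ∘ suc)
∑-allFin-suc n f = cong (_+_ (f zero)) (∑-tabulate suc f)

∑-allFin-𝟙 : {i : Fin n} (h : Fin n → ℕ) → (∑[ j ∈ allFin n ] 𝟙 (i ≟F j) * h j) ≡ h i
∑-allFin-𝟙 {suc n} {zero} h =
  trans (∑-allFin-suc n (λ j → 𝟙 (zero ≟F j) * h j)) (trans (cong (_+_ (1 * h zero)) (∑-zero (allFin n)))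
  (trans (+-identityʳ _) (*-identityˡ (h zero))))
∑-allFin-𝟙 {suc n} {suc i} h = trans (∑-allFin-suc n (λ j → 𝟙 (suc i ≟F j) * h j))
  (trans (∑-cong (allFin n) λ j → cong (_* h (suc j)) (𝟙-cong (suc i ≟F suc j) (i ≟F j) Fin.suc-injective (cong suc)))
         (∑-allFin-𝟙 (h ∘ suc)))

_≟V_ : {d : ℕ} (x y : Zn^ n d) → Dec (x ≡ y)
_≟V_ = ≡-dec _≟F_

𝟙-∷ : {d : ℕ} (i j : Fin n) (is js : Zn^ n d) → 𝟙 ((i ∷ is) ≟V (j ∷ js)) ≡ 𝟙 (i ≟F j) * 𝟙 (is ≟V js)
𝟙-∷ i j is js = trans
  (𝟙-cong ((i ∷ is) ≟V (j ∷ js)) ((i ≟F j) ×-dec (is ≟V js)) ∷-injective (λ (p , q) → cong₂ _∷_ p q))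
  (𝟙-× (i ≟F j) (is ≟V js))

∑-allZn-𝟙 : {d : ℕ} (i : Zn^ n d) (h : Zn^ n d → ℕ) → (∑[ j ∈ allZn n d ] 𝟙 (i ≟V j) * h j) ≡ h i
∑-allZn-𝟙 {d = zero}  []       h = trans (+-identityʳ _) (*-identityˡ (h []))
∑-allZn-𝟙 {n} {d = suc d} (i ∷ is) h =
  trans (∑-allVecsOf (allFin n) d _)
  (trans (∑-cong (allFin n) λ j →
    trans (∑-cong (allZn n d) λ js →
            trans (cong (_* h (j ∷ js)) (𝟙-∷ i j is js)) (*-assoc (𝟙 (i ≟F j)) _ _))
    (trans (∑-*ˡ (allZn n d) (𝟙 (i ≟F j)) _) (cong (𝟙 (i ≟F j) *_) (∑-allZn-𝟙 is (h ∘ (j ∷_))))))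
  (∑-allFin-𝟙 (λ j → h (j ∷ is))))

-- With the summand defined on `ℕ`, the second block is a mere shift and no casts between `Fin`
-- types arise.
∑-allFin-+ : ∀ m n (f : ℕ → ℕ) →
             (∑[ i ∈ allFin (m + n) ] f (toℕ i)) ≡ (∑[ i ∈ allFin m ] f (toℕ i)) + (∑[ i ∈ allFin n ] f (m + toℕ i))
∑-allFin-+ zero    n f = refl
∑-allFin-+ (suc m) n f = trans (∑-allFin-suc (m + n) _)
  (trans (cong (_+_ (f 0)) (∑-allFin-+ m n (f ∘ suc)))
  (trans (sym (+-assoc (f 0) _ _)) (cong (_+ (∑[ i ∈ allFin n ] f (suc m + toℕ i))) (sym (∑-allFin-suc m _)))))

∑-𝟙-unique : {R : Fin n → Set} (R? : Decidable R) → (∀ i j → R i → R j → i ≡ j) → (∑[ i ∈ allFin n ] 𝟙 (R? i)) ≤ 1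
∑-𝟙-unique {zero}  R? unique = z≤n
∑-𝟙-unique {suc n} R? unique = ≤-trans (≤-reflexive (∑-allFin-suc n (λ i → 𝟙 (R? i)))) (go (R? zero))
  where
  tail : ℕ
  tail = ∑[ i ∈ allFin n ] 𝟙 (R? (suc i))
  go : Dec _ → 𝟙 (R? zero) + tail ≤ 1
  go (no ¬R0) = subst (_≤ 1) (cong (_+ tail) (sym (𝟙-no (R? zero) ¬R0)))
    (∑-𝟙-unique (R? ∘ suc) (λ i j p q → Fin.suc-injective (unique (suc i) (suc j) p q)))
  go (yes R0) = ≤-reflexive (cong₂ _+_ (𝟙-yes (R? zero) R0)
    (trans (∑-cong (allFin n) λ i → 𝟙-no (R? (suc i)) λ Ri → Fin.0≢1+n (unique zero (suc i) R0 Ri)) (∑-zero (allFin n))))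

-- Linear congruences

-- Since `j ∸ i` is at most `j`, hence below `q`, it can be a multiple of `q` only when it is `0`.
∸-residue : ∀ {q} i j → j < q → q ∣ j ∸ i → j ≤ i
∸-residue i j j<q q∣j∸i with j ∸ i in eq
... | zero  = m∸n≡0⇒m≤n eq
... | suc r = ⊥-elim (ℕ∣.>⇒∤ (≤-<-trans (≤-trans (≤-reflexive (sym eq)) (m∸n≤m j i)) j<q) q∣j∸i)

residue-≤ : ∀ {q} i j → j < q → + q ∣ᶻ (+ i ℤ.- + j) → j ≤ i
residue-≤ {q} i j j<q q∣i-j with ≤-total i j
... | inj₂ j≤i = j≤i
... | inj₁ i≤j = ∸-residue i j j<q (subst (q ∣_)
        (trans (cong ∣_∣ (ℤ.[+m]-[+n]≡m⊖n i j)) (ℤ.∣⊖∣-≤ i≤j)) (ℤ∣.∣⇒∣ᵤ q∣i-j))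

residue-unique : ∀ {q} (i j : Fin q) → + q ∣ᶻ (+ toℕ i ℤ.- + toℕ j) → i ≡ j
residue-unique {q} i j q∣i-j = Fin.toℕ-injective (≤-antisym
  (residue-≤ (toℕ j) (toℕ i) (Fin.toℕ<n i) (subst (+ q ∣ᶻ_) (negate (+ toℕ i) (+ toℕ j)) (ℤ∣.∣m⇒∣-m q∣i-j)))
  (residue-≤ (toℕ i) (toℕ j) (Fin.toℕ<n j) q∣i-j))
  where
  negate : ∀ a b → ℤ.- (a ℤ.- b) ≡ b ℤ.- a
  negate = ℤsolve-∀

-- For positive `q` this means that `u` is a unit modulo `q`, in the form in which the counting uses
-- it.
Cancels : ℕ → ℤ → Set
Cancels q u = ∀ t → + q ∣ᶻ (u ℤ.* t) → + q ∣ᶻ t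

-- The range splits into `m` blocks of `q` consecutive integers. Two solutions in one block differ
-- by a multiple of `q`, because `u` cancels, and so coincide. Passing to the next block only
-- changes `c`, which is therefore arbitrary.
count-progression : ∀ m q (c u : ℤ) → Cancels q u →
                    (∑[ i ∈ allFin (m * q) ] 𝟙 (+ q ∣ᶻ? (c ℤ.+ u ℤ.* + toℕ i))) ≤ m
count-progression zero    q c u cancel = z≤n
count-progression (suc m) q c u cancel = ≤-trans
  (≤-reflexive (∑-allFin-+ q (m * q) (λ i → 𝟙 (+ q ∣ᶻ? (c ℤ.+ u ℤ.* + i)))))
  (+-mono-≤
    (∑-𝟙-unique (λ i → + q ∣ᶻ? (c ℤ.+ u ℤ.* + toℕ i)) λ i j q∣i q∣j → residue-unique i j (cancel _
      (subst (+ q ∣ᶻ_) (difference c u (+ toℕ i) (+ toℕ j)) (ℤ∣.∣m∣n⇒∣m-n q∣i q∣j))))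
    (≤-trans
      (≤-reflexive (∑-cong (allFin (m * q)) λ i → cong (λ z → 𝟙 (+ q ∣ᶻ? z)) (shift c u (+ q) (+ toℕ i))))
      (count-progression m q (c ℤ.+ u ℤ.* + q) u cancel)))
  where
  difference : ∀ c u i j → (c ℤ.+ u ℤ.* i) ℤ.- (c ℤ.+ u ℤ.* j) ≡ u ℤ.* (i ℤ.- j)
  difference = ℤsolve-∀
  shift : ∀ c u q i → c ℤ.+ u ℤ.* (q ℤ.+ i) ≡ (c ℤ.+ u ℤ.* q) ℤ.+ u ℤ.* i
  shift = ℤsolve-∀

coprime-cancels : ∀ {q} u → Coprime q ∣ u ∣ → Cancels q u
coprime-cancels {q} u q⊥u t q∣ut =
  ℤ∣.∣ᵤ⇒∣ (coprime-divisor q⊥u (subst (q ∣_) (ℤ.abs-* u t) (ℤ∣.∣⇒∣ᵤ q∣ut)))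

-- The summand of ‖x − y‖ − ‖x′ − y‖ in one coordinate is a(b − 2y) with a = x − x′ and b = x + x′.
affine : ℤ → ℤ → ℤ → ℤ
affine a b y = a ℤ.* (b ℤ.- + 2 ℤ.* y)

coprime-* : ∀ {q a b} → Coprime q a → Coprime q b → Coprime q (a * b)
coprime-* q⊥a q⊥b (r∣q , r∣ab) =
  q⊥b (r∣q , coprime-divisor (λ (s∣r , s∣a) → q⊥a (ℕ∣.∣-trans s∣r r∣q , s∣a)) r∣ab)

-- Dividing by `h` leaves a congruence modulo `q` whose leading coefficient `-2a` is coprime to `q`,
-- and the range consists of `m * h` blocks of length `q`.
count-affine-scaled : ∀ m q h (a b e : ℤ) .{{_ : NonZero h}} → Coprime q 2 → Coprime q ∣ a ∣ →
                      (∑[ y ∈ allFin (m * (q * h)) ] 𝟙 (+ (q * h) ∣ᶻ? (e ℤ.* + h ℤ.+ affine (a ℤ.* + h) b (+ toℕ y)))) ≤ m * h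
count-affine-scaled m q h a b e q⊥2 q⊥a = subst
  (λ N → (∑[ y ∈ allFin N ] 𝟙 (+ (q * h) ∣ᶻ? (e ℤ.* + h ℤ.+ affine (a ℤ.* + h) b (+ toℕ y)))) ≤ m * h)
  (arrange m q h)
  (≤-trans (∑-mono (allFin (m * h * q)) λ y → 𝟙-mono (+ (q * h) ∣ᶻ? (e ℤ.* + h ℤ.+ affine (a ℤ.* + h) b (+ toℕ y))) (+ q ∣ᶻ? (c ℤ.+ u ℤ.* + toℕ y)) λ qh∣ →
             ℤ∣.*-cancelʳ-∣ (+ h) (subst₂ _∣ᶻ_ (ℤ.pos-* q h) (factor e (+ h) a b (+ toℕ y)) qh∣))
           (count-progression (m * h) q c u
             (coprime-cancels u (subst (Coprime q) (sym (ℤ.abs-* -[1+ 1 ] a)) (coprime-* q⊥2 q⊥a)))))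
  where
  c = e ℤ.+ a ℤ.* b
  u = -[1+ 1 ] ℤ.* a
  arrange : ∀ m q h → m * h * q ≡ m * (q * h)
  arrange = solve-∀
  factor : ∀ e h a b y → e ℤ.* h ℤ.+ affine (a ℤ.* h) b y ≡ (e ℤ.+ a ℤ.* b ℤ.+ (-[1+ 1 ] ℤ.* a) ℤ.* y) ℤ.* h
  factor e h a b y = lemma e h a b y
    where
    lemma : ∀ e h a b y → e ℤ.* h ℤ.+ (a ℤ.* h) ℤ.* (b ℤ.- + 2 ℤ.* y) ≡ (e ℤ.+ a ℤ.* b ℤ.+ (-[1+ 1 ] ℤ.* a) ℤ.* y) ℤ.* h
    lemma = ℤsolve-∀

-- With `h = gcd ∣ a ∣ g`, a solution requires `h ∣ e`. In that case `a`, `e` and `g` can all be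
-- divided by `h`, and `g / h` is coprime to `a / h`. The indicator on the right is kept because, in
-- the induction over the coordinates, it is the congruence left for the next coordinate.
count-affine : ∀ {n} g .{{_ : NonZero g}} (a b e : ℤ) → Coprime g 2 → g ∣ n →
               g * (∑[ y ∈ allFin n ] 𝟙 (+ g ∣ᶻ? (e ℤ.+ affine a b (+ toℕ y)))) ≤
               n * (gcd ∣ a ∣ g * 𝟙 (+ gcd ∣ a ∣ g ∣ᶻ? e))
count-affine g a b e g⊥2 (divides-refl m) = go (+ h ∣ᶻ? e)
  where
  open ≤-Reasoning
  h = gcd ∣ a ∣ g
  instance
    h≢0 : NonZero h
    h≢0 = ≢-nonZero (gcd[m,n]≢0 ∣ a ∣ g (inj₂ (≢-nonZero⁻¹ g)))
  h∣a : + h ∣ᶻ a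
  h∣a = ℤ∣.∣ᵤ⇒∣ (gcd[m,n]∣m ∣ a ∣ g)
  q = g / h
  a₁ = ℤ∣._∣_.quotient h∣a
  a≡ : a ≡ a₁ ℤ.* + h
  a≡ = ℤ∣._∣_.equality h∣a
  q*h≡g : q * h ≡ g
  q*h≡g = m/n*n≡m (gcd[m,n]∣n ∣ a ∣ g)
  count : ℕ → ℤ → ℤ → ℕ
  count g a e = ∑[ y ∈ allFin (m * g) ] 𝟙 (+ g ∣ᶻ? (e ℤ.+ affine a b (+ toℕ y)))
  q⊥2 : Coprime q 2
  q⊥2 (r∣q , r∣2) = g⊥2 (ℕ∣.∣-trans r∣q (divides h (trans (sym q*h≡g) (*-comm q h))) , r∣2)
  ∣a₁∣≡ : ∣ a ∣ / h ≡ ∣ a₁ ∣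
  ∣a₁∣≡ = trans (cong (_/ h) (trans (cong ∣_∣ a≡) (ℤ.abs-* a₁ (+ h)))) (m*n/n≡m ∣ a₁ ∣ h)
  q⊥a₁ : Coprime q ∣ a₁ ∣
  q⊥a₁ = Coprimality.sym (subst (λ z → Coprime z q) ∣a₁∣≡ (coprime-/gcd ∣ a ∣ g))
  arrange : ∀ g m h → g * (m * h) ≡ m * g * (h * 1)
  arrange = solve-∀
  go : Dec (+ h ∣ᶻ e) → g * count g a e ≤ m * g * (h * 𝟙 (+ h ∣ᶻ? e))
  go (yes h∣e@(ℤ∣.divides e₁ e≡)) = begin
    g * count g a e                 ≤⟨ *-monoʳ-≤ g bound ⟩
    g * (m * h)                     ≡⟨ arrange g m h ⟩
    m * g * (h * 1)                 ≡⟨ cong (λ z → m * g * (h * z)) (sym (𝟙-yes (+ h ∣ᶻ? e) h∣e)) ⟩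
    m * g * (h * 𝟙 (+ h ∣ᶻ? e))     ∎
    where
    bound : count g a e ≤ m * h
    bound = subst (_≤ m * h)
      (trans (cong (λ g → count g (a₁ ℤ.* + h) (e₁ ℤ.* + h)) q*h≡g) (cong₂ (count g) (sym a≡) (sym e≡)))
      (count-affine-scaled m q h a₁ b e₁ q⊥2 q⊥a₁)
  go (no h∤e) = begin
    g * count g a e                 ≡⟨ cong (g *_) (trans (∑-cong (allFin (m * g)) none) (∑-zero (allFin (m * g)))) ⟩
    g * 0                           ≡⟨ *-zeroʳ g ⟩
    0                               ≤⟨ z≤n ⟩
    m * g * (h * 𝟙 (+ h ∣ᶻ? e))     ∎
    where
    -- `h` divides `g` and every value of the affine term, so a single solution would force `h ∣ e`.
    none : ∀ y → 𝟙 (+ g ∣ᶻ? (e ℤ.+ affine a b (+ toℕ y))) ≡ 0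
    none y = 𝟙-no (+ g ∣ᶻ? (e ℤ.+ affine a b (+ toℕ y))) λ g∣ → h∤e
      (ℤ∣.∣m+n∣n⇒∣m (ℤ∣.∣-trans (ℤ∣.∣ᵤ⇒∣ (gcd[m,n]∣n ∣ a ∣ g)) g∣) (ℤ∣.∣m⇒∣m*n _ h∣a))

odd⇒coprime-2 : ∀ {g} → n % 2 ≡ 1 → g ∣ n → Coprime g 2
odd⇒coprime-2 {n} odd g∣n {r} (r∣g , r∣2) = go r (ℕ∣.∣⇒≤ r∣2) r∣2 (ℕ∣.∣-trans r∣g g∣n)
  where
  go : ∀ r → r ≤ 2 → r ∣ 2 → r ∣ n → r ≡ 1
  go 0 _ 0∣2 _ with () ← ℕ∣.0∣⇒≡0 0∣2
  go 1 _ _ _ = refl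
  go 2 _ _ 2∣n with () ← trans (sym odd) (ℕ∣.n∣m⇒m%n≡0 n 2 2∣n)
  go (suc (suc (suc _))) (s≤s (s≤s ())) _ _

-- Apices equidistant from two points

diff : Fin n → Fin n → ℤ
diff i j = + toℕ i ℤ.- + toℕ j

-- This is gcd(n, x₁ - x′₁, ..., x_d - x′_d). Starting from `n` makes it a divisor of `n`, equal to
-- `n` when the points coincide.
content : {d : ℕ} → Zn^ n d → Zn^ n d → ℕ
content {n} []       []         = n
content     (x ∷ xs) (x′ ∷ xs′) = gcd ∣ diff x x′ ∣ (content xs xs′)

content∣n : {d : ℕ} (x x′ : Zn^ n d) → content x x′ ∣ n
content∣n []       []         = ℕ∣.∣-refl
content∣n (x ∷ xs) (x′ ∷ xs′) = ℕ∣.∣-trans (gcd[m,n]∣n ∣ diff x x′ ∣ (content xs xs′)) (content∣n xs xs′)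

content-nonZero : .{{_ : NonZero n}} {d : ℕ} (x x′ : Zn^ n d) → NonZero (content x x′)
content-nonZero {n} x x′ = ≢-nonZero λ c≡0 →
  ≢-nonZero⁻¹ n (ℕ∣.0∣⇒≡0 (subst (_∣ n) c≡0 (content∣n x x′)))

-- An integer representative of ‖x - y‖ - ‖x′ - y‖ in which `y` occurs only linearly. It is
-- congruent modulo `n` to the difference of the two `sqNorm`s, in general not equal to it.
normDiff : {d : ℕ} → Zn^ n d → Zn^ n d → Zn^ n d → ℤ
normDiff []       []         []       = + 0
normDiff (x ∷ xs) (x′ ∷ xs′) (y ∷ ys) =
  affine (diff x x′) (+ toℕ x ℤ.+ + toℕ x′) (+ toℕ y) ℤ.+ normDiff xs xs′ ys

-- Induction on the coordinates. Once the first coordinate `y` is fixed, the others solve the same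
-- problem with constant `e + t y`, hence the arbitrary `e`. They can do so only if the content `g`
-- of the tails divides `e + t y`, and `count-affine` counts the `y` with that property.
count-solutions : .{{_ : NonZero n}} → n % 2 ≡ 1 → {d : ℕ} (x x′ : Zn^ n d) (e : ℤ) →
                  n * (∑[ y ∈ allZn n d ] 𝟙 (+ n ∣ᶻ? (e ℤ.+ normDiff x x′ y))) ≤
                  n ^ d * (content x x′ * 𝟙 (+ content x x′ ∣ᶻ? e))
count-solutions {n} odd [] [] e = ≤-reflexive
  (trans (cong (n *_) (trans (+-identityʳ _) (cong (λ z → 𝟙 (+ n ∣ᶻ? z)) (ℤ.+-identityʳ e)))) (sym (*-identityˡ _)))
count-solutions {n} odd {suc d} (x ∷ xs) (x′ ∷ xs′) e = begin
  n * (∑[ y ∈ allZn n (suc d) ] 𝟙 (+ n ∣ᶻ? (e ℤ.+ normDiff (x ∷ xs) (x′ ∷ xs′) y)))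
    ≡⟨ cong (n *_) (∑-allVecsOf (allFin n) d _) ⟩
  n * (∑[ y ∈ allFin n ] ∑[ ys ∈ allZn n d ] 𝟙 (+ n ∣ᶻ? (e ℤ.+ (t y ℤ.+ normDiff xs xs′ ys))))
    ≡⟨ sym (∑-*ˡ (allFin n) n _) ⟩
  (∑[ y ∈ allFin n ] n * (∑[ ys ∈ allZn n d ] 𝟙 (+ n ∣ᶻ? (e ℤ.+ (t y ℤ.+ normDiff xs xs′ ys)))))
    ≡⟨ (∑-cong (allFin n) λ y → cong (n *_) (∑-cong (allZn n d) λ ys →
          cong (λ z → 𝟙 (+ n ∣ᶻ? z)) (sym (ℤ.+-assoc e (t y) (normDiff xs xs′ ys))))) ⟩
  (∑[ y ∈ allFin n ] n * (∑[ ys ∈ allZn n d ] 𝟙 (+ n ∣ᶻ? (e ℤ.+ t y ℤ.+ normDiff xs xs′ ys))))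
    ≤⟨ (∑-mono (allFin n) λ y → count-solutions odd xs xs′ (e ℤ.+ t y)) ⟩
  (∑[ y ∈ allFin n ] n ^ d * (g * 𝟙 (+ g ∣ᶻ? (e ℤ.+ t y))))
    ≡⟨ trans (∑-*ˡ (allFin n) (n ^ d) _) (cong (n ^ d *_) (∑-*ˡ (allFin n) g _)) ⟩
  n ^ d * (g * (∑[ y ∈ allFin n ] 𝟙 (+ g ∣ᶻ? (e ℤ.+ t y))))
    ≤⟨ *-monoʳ-≤ (n ^ d) (count-affine g (diff x x′) (+ toℕ x ℤ.+ + toℕ x′) e (odd⇒coprime-2 odd (content∣n xs xs′)) (content∣n xs xs′)) ⟩
  n ^ d * (n * H)
    ≡⟨ arrange (n ^ d) n H ⟩
  n ^ suc d * H ∎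
  where
  open ≤-Reasoning
  t : Fin n → ℤ
  t y = affine (diff x x′) (+ toℕ x ℤ.+ + toℕ x′) (+ toℕ y)
  g = content xs xs′
  H = content (x ∷ xs) (x′ ∷ xs′) * 𝟙 (+ content (x ∷ xs) (x′ ∷ xs′) ∣ᶻ? e)
  instance
    g≢0 : NonZero g
    g≢0 = content-nonZero xs xs′
  arrange : ∀ a b c → a * (b * c) ≡ b * a * c
  arrange = solve-∀

-- The natural number that `sqDist` reduces modulo `n`.
sqNorm : {d : ℕ} → Zn^ n d → Zn^ n d → ℕ
sqNorm {n} x y = foldr (λ _ → ℕ) _+_ 0 (zipWith (λ a b → (toℕ a + (n ∸ toℕ b)) ^ 2) x y)

pos-^2 : ∀ a → + (a ^ 2) ≡ + a ℤ.* + a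
pos-^2 a = trans (cong +_ (cong (a *_) (*-identityʳ a))) (ℤ.pos-* a a)

pos-∸ : ∀ {a b} → b ≤ a → + (a ∸ b) ≡ + a ℤ.- + b
pos-∸ {a} {b} b≤a = sym (trans (ℤ.[+m]-[+n]≡m⊖n a b) (ℤ.⊖-≥ b≤a))

-- `sqDist` represents -y by n - y. In each coordinate this turns (x - x′)(x + x′ - 2y) into (x -
-- x′)(x + x′ - 2y + 2n), an error of 2(x - x′)n.
sqNorm-normDiff : {d : ℕ} (x x′ y : Zn^ n d) → + n ∣ᶻ ((+ sqNorm x y ℤ.- + sqNorm x′ y) ℤ.- normDiff x x′ y)
sqNorm-normDiff []       []         []       = ℤ∣.∣ᵤ⇒∣ (_ ℕ∣.∣0)
sqNorm-normDiff {n} (x ∷ xs) (x′ ∷ xs′) (y ∷ ys) = subst (+ n ∣ᶻ_)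
  (trans (expand (+ toℕ x) (+ toℕ x′) (+ toℕ y) (+ n) (+ sqNorm xs ys) (+ sqNorm xs′ ys) (normDiff xs xs′ ys))
    (cong₂ (λ a b → ((a ℤ.+ + sqNorm xs ys) ℤ.- (b ℤ.+ + sqNorm xs′ ys)) ℤ.- normDiff (x ∷ xs) (x′ ∷ xs′) (y ∷ ys))
           (sym (square x)) (sym (square x′))))
  (ℤ∣.∣m∣n⇒∣m+n (ℤ∣.∣n⇒∣m*n (+ 2 ℤ.* diff x x′) ℤ∣.∣-refl) (sqNorm-normDiff xs xs′ ys))
  where
  square : ∀ z → + ((toℕ z + (n ∸ toℕ y)) ^ 2) ≡ (+ toℕ z ℤ.+ (+ n ℤ.- + toℕ y)) ℤ.* (+ toℕ z ℤ.+ (+ n ℤ.- + toℕ y))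
  square z = trans (pos-^2 (toℕ z + (n ∸ toℕ y)))
    (cong (λ w → (+ toℕ z ℤ.+ w) ℤ.* (+ toℕ z ℤ.+ w)) (pos-∸ (<⇒≤ (Fin.toℕ<n y))))
  expand : ∀ x x′ y n s s′ l → (+ 2 ℤ.* (x ℤ.- x′)) ℤ.* n ℤ.+ ((s ℤ.- s′) ℤ.- l) ≡
           (((x ℤ.+ (n ℤ.- y)) ℤ.* (x ℤ.+ (n ℤ.- y)) ℤ.+ s) ℤ.- ((x′ ℤ.+ (n ℤ.- y)) ℤ.* (x′ ℤ.+ (n ℤ.- y)) ℤ.+ s′))
           ℤ.- ((x ℤ.- x′) ℤ.* ((x ℤ.+ x′) ℤ.- + 2 ℤ.* y) ℤ.+ l)
  expand = ℤsolve-∀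

mod-≡⇒∣ : ∀ a b .{{_ : NonZero n}} → a mod n ≡ b mod n → + n ∣ᶻ (+ a ℤ.- + b)
mod-≡⇒∣ {n} a b eq = subst (+ n ∣ᶻ_)
  (sym (trans (cong₂ ℤ._-_ (decompose a) (trans (decompose b) (cong (λ r → + r ℤ.+ + (b / n) ℤ.* + n) (sym rem≡)))) (cancel (+ (a % n)) (+ (a / n)) (+ (b / n)) (+ n))))
  (ℤ∣.∣n⇒∣m*n (+ (a / n) ℤ.- + (b / n)) ℤ∣.∣-refl)
  where
  rem≡ : a % n ≡ b % n
  rem≡ = trans (sym (Fin.toℕ-fromℕ< (m%n<n a n))) (trans (cong toℕ eq) (Fin.toℕ-fromℕ< (m%n<n b n)))
  decompose : ∀ c → + c ≡ + (c % n) ℤ.+ + (c / n) ℤ.* + n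
  decompose c = trans (cong +_ (m≡m%n+[m/n]*n c n)) (cong (λ w → + (c % n) ℤ.+ w) (ℤ.pos-* (c / n) n))
  cancel : ∀ r p q n → (r ℤ.+ p ℤ.* n) ℤ.- (r ℤ.+ q ℤ.* n) ≡ (p ℤ.- q) ℤ.* n
  cancel = ℤsolve-∀

sqDist-≡⇒∣ : .{{_ : NonZero n}} {d : ℕ} (x x′ y : Zn^ n d) → sqDist x y ≡ sqDist x′ y → + n ∣ᶻ normDiff x x′ y
sqDist-≡⇒∣ {n} x x′ y eq = subst (+ n ∣ᶻ_) (cancel (+ sqNorm x y ℤ.- + sqNorm x′ y) (normDiff x x′ y))
  (ℤ∣.∣m∣n⇒∣m-n (mod-≡⇒∣ (sqNorm x y) (sqNorm x′ y) eq) (sqNorm-normDiff x x′ y))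
  where
  cancel : ∀ a b → a ℤ.- (a ℤ.- b) ≡ b
  cancel = ℤsolve-∀

-- The case `e = 0` of `count-solutions`, where the indicator on the right is `1`.
count-equidistant : .{{_ : NonZero n}} → n % 2 ≡ 1 → {d : ℕ} (x x′ : Zn^ n d) →
                    n * (∑[ y ∈ allZn n d ] 𝟙 (sqDist x y ≟F sqDist x′ y)) ≤ n ^ d * content x x′
count-equidistant {n} odd {d} x x′ = begin
  n * (∑[ y ∈ allZn n d ] 𝟙 (sqDist x y ≟F sqDist x′ y))
    ≤⟨ *-monoʳ-≤ n (∑-mono (allZn n d) λ y → 𝟙-mono (sqDist x y ≟F sqDist x′ y) (+ n ∣ᶻ? (+ 0 ℤ.+ normDiff x x′ y))
         λ eq → subst (+ n ∣ᶻ_) (sym (ℤ.+-identityˡ _)) (sqDist-≡⇒∣ x x′ y eq)) ⟩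
  n * (∑[ y ∈ allZn n d ] 𝟙 (+ n ∣ᶻ? (+ 0 ℤ.+ normDiff x x′ y)))
    ≤⟨ count-solutions odd x x′ (+ 0) ⟩
  n ^ d * (content x x′ * 𝟙 (+ content x x′ ∣ᶻ? + 0))
    ≡⟨ cong (n ^ d *_) (trans (cong (content x x′ *_) (𝟙-yes (+ content x x′ ∣ᶻ? + 0) (ℤ∣.∣ᵤ⇒∣ (_ ℕ∣.∣0)))) (*-identityʳ _)) ⟩
  n ^ d * content x x′ ∎
  where open ≤-Reasoning

-- Divisors

-- The list inside `τ`, so that `τ n` is its length by definition.
divisors : ℕ → List ℕ
divisors n = filter (λ m → m ∣? n) (L.map suc (upTo n))

∈-divisors : ∀ {g} .{{_ : NonZero n}} → g ∣ n → g ∈ divisors n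
∈-divisors {n} {zero}  0∣n = ⊥-elim (≢-nonZero⁻¹ n (ℕ∣.0∣⇒≡0 0∣n))
∈-divisors {n} {suc g} g∣n = ∈-filter⁺ (λ m → m ∣? n) (∈-map⁺ suc (∈-upTo⁺ (ℕ∣.∣⇒≤ g∣n))) g∣n

τ-nonZero : ∀ n .{{_ : NonZero n}} → NonZero (τ n)
τ-nonZero n with divisors n | ∈-divisors (ℕ∣.∣-refl {n})
... | _ ∷ _ | _ = _

prime-divisor : ∀ g → 2 ≤ g → Σ ℕ λ p → Prime p × p ∣ g
prime-divisor (suc g) 2≤g with factorise (suc g)
... | record { factors = [] ; isFactorisation = g≡1 } = ⊥-elim (<⇒≢ 2≤g (sym g≡1))
... | record { factors = p ∷ ps ; isFactorisation = g≡ ; factorsPrime = pr All.∷ _ } =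
  p , pr , divides (Data.Nat.ListAction.product ps) (trans g≡ (*-comm p _))

-- `γ n` is the head of a filtered initial segment of `ℕ`. That list is sorted and contains `p`, so
-- its head is at most `p`.
γ-minimal : ∀ {n p} .{{_ : NonZero n}} → Prime p → p ∣ n → γ n ≤ p
γ-minimal {n} {p} pr p∣n
  with filter (λ p → prime? p ×-dec p ∣? n) (upTo (suc n))
     | ∈-filter⁺ (λ p → prime? p ×-dec p ∣? n) (∈-upTo⁺ (s≤s (ℕ∣.∣⇒≤ p∣n))) (pr , p∣n)
     | AllPairs.filter⁺ (λ p → prime? p ×-dec p ∣? n) (AllPairs.applyUpTo⁺₁ {R = _≤_} id (suc n) (λ i<j _ → <⇒≤ i<j))
... | []    | ()         | _
... | _ ∷ _ | here refl  | _                  = ≤-refl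
... | _ ∷ _ | there p∈ps | q≤ps AllPairs.∷ _ = All.lookup q≤ps p∈ps

γ-≤-divisor : ∀ {n g} .{{_ : NonZero n}} → 2 ≤ g → g ∣ n → γ n ≤ g
γ-≤-divisor {n} {suc g} 2≤g g∣n with prime-divisor (suc g) 2≤g
... | p , pr , p∣g = ≤-trans (γ-minimal pr (ℕ∣.∣-trans p∣g g∣n)) (ℕ∣.∣⇒≤ p∣g)

-- Averages of the content

congruent : ℕ → {d : ℕ} → Zn^ n d → Zn^ n d → ℕ
congruent g []       []         = 1
congruent g (x ∷ xs) (x′ ∷ xs′) = 𝟙 (+ g ∣ᶻ? diff x x′) * congruent g xs xs′

congruent-yes : ∀ g {d} (x x′ : Zn^ n d) → g ∣ content x x′ → congruent g x x′ ≡ 1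
congruent-yes g []       []         g∣ = refl
congruent-yes g (x ∷ xs) (x′ ∷ xs′) g∣ = cong₂ _*_
  (𝟙-yes (+ g ∣ᶻ? diff x x′) (ℤ∣.∣ᵤ⇒∣ (ℕ∣.∣-trans g∣ (gcd[m,n]∣m ∣ diff x x′ ∣ (content xs xs′)))))
  (congruent-yes g xs xs′ (ℕ∣.∣-trans g∣ (gcd[m,n]∣n ∣ diff x x′ ∣ (content xs xs′))))

-- `count-progression` with `u = -1`.
count-residue : ∀ {g} (x : Fin n) → g ∣ n → g * (∑[ x′ ∈ allFin n ] 𝟙 (+ g ∣ᶻ? diff x x′)) ≤ n
count-residue {g = g} x (divides-refl m) = ≤-trans
  (*-monoʳ-≤ g (≤-trans
    (≤-reflexive (∑-cong (allFin (m * g)) λ x′ → cong (λ z → 𝟙 (+ g ∣ᶻ? z)) (negate (+ toℕ x) (+ toℕ x′))))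
    (count-progression m g (+ toℕ x) -[1+ 0 ] λ t g∣ → subst (+ g ∣ᶻ_) (involutive t) (ℤ∣.∣m⇒∣-m g∣))))
  (≤-reflexive (*-comm g m))
  where
  negate : ∀ a b → a ℤ.- b ≡ a ℤ.+ -[1+ 0 ] ℤ.* b
  negate = ℤsolve-∀
  involutive : ∀ t → ℤ.- (-[1+ 0 ] ℤ.* t) ≡ t
  involutive = ℤsolve-∀

-- `congruent` is a product over the coordinates, so its sum factors and `count-residue` applies to
-- each factor.
count-congruent : ∀ {g d} (x : Zn^ n d) → g ∣ n → g ^ d * (∑[ x′ ∈ allZn n d ] congruent g x x′) ≤ n ^ d
count-congruent []       g∣n = ≤-refl
count-congruent {n} {g} {suc d} (x ∷ xs) g∣n = begin
  g ^ suc d * (∑[ x′ ∈ allZn n (suc d) ] congruent g (x ∷ xs) x′)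
    ≡⟨ cong (g ^ suc d *_) (trans (∑-allVecsOf (allFin n) d _) (sym (∑-*-∑ (allFin n) (allZn n d) _ _))) ⟩
  g * g ^ d * (residues * congruents)
    ≡⟨ arrange g (g ^ d) residues congruents ⟩
  g * residues * (g ^ d * congruents)
    ≤⟨ *-mono-≤ (count-residue x g∣n) (count-congruent xs g∣n) ⟩
  n ^ suc d ∎
  where
  open ≤-Reasoning
  residues = ∑[ x′ ∈ allFin n ] 𝟙 (+ g ∣ᶻ? diff x x′)
  congruents = ∑[ xs′ ∈ allZn n d ] congruent g xs xs′
  arrange : ∀ a b c e → a * b * (c * e) ≡ a * c * (b * e)
  arrange = solve-∀

-- A sum over all nontrivial divisors, bounding the content by 1 + excess while being easy to average.
excess : {d : ℕ} → Zn^ n d → Zn^ n d → ℕ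
excess {n} x x′ = ∑[ g ∈ divisors n ] 𝟙 (2 ≤? g) * (g * congruent g x x′)

∑-∈ : {xs : List A} {x : A} (f : A → ℕ) → x ∈ xs → f x ≤ ∑ xs f
∑-∈ f (here refl)          = m≤m+n _ _
∑-∈ {xs = y ∷ _} f (there x∈xs) = ≤-trans (∑-∈ f x∈xs) (m≤n+m _ (f y))

-- The content `g` is itself one of the divisors in `excess`, and its own term equals `g` when
-- `g ≥ 2`. For smaller `g` the summand `1` suffices.
content≤1+excess : .{{_ : NonZero n}} {d : ℕ} (x x′ : Zn^ n d) → content x x′ ≤ 1 + excess x x′
content≤1+excess {n} x x′ = go (2 ≤? content x x′)
  where
  g = content x x′
  term≡g : 2 ≤ g → 𝟙 (2 ≤? g) * (g * congruent g x x′) ≡ g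
  term≡g 2≤g = trans (cong₂ (λ a b → a * (g * b)) (𝟙-yes (2 ≤? g) 2≤g) (congruent-yes g x x′ ℕ∣.∣-refl))
    (trans (*-identityˡ _) (*-identityʳ g))
  go : Dec (2 ≤ g) → g ≤ 1 + excess x x′
  go (no 2≰g)  = ≤-trans (s≤s⁻¹ (≰⇒> 2≰g)) (s≤s z≤n)
  go (yes 2≤g) = ≤-trans (≤-reflexive (sym (term≡g 2≤g)))
    (≤-trans (∑-∈ (λ g → 𝟙 (2 ≤? g) * (g * congruent g x x′)) (∈-divisors (content∣n x x′))) (n≤1+n _))

∑-mono-∈ : (xs : List A) {f g : A → ℕ} → (∀ x → x ∈ xs → f x ≤ g x) → ∑ xs f ≤ ∑ xs g
∑-mono-∈ []       f≤g = z≤n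
∑-mono-∈ (x ∷ xs) f≤g = +-mono-≤ (f≤g x (here refl)) (∑-mono-∈ xs λ y y∈xs → f≤g y (there y∈xs))

-- After exchanging the sums, each of the `τ n` divisors is treated alone, and `n ^ d` bounds the
-- contribution of each.
excess-average : .{{_ : NonZero n}} {d : ℕ} → 1 ≤ d → (x : Zn^ n d) →
                 γ n ^ (d ∸ 1) * (∑[ x′ ∈ allZn n d ] excess x x′) ≤ τ n * n ^ d
excess-average {n} {suc d} _ x = begin
  Γ * (∑[ x′ ∈ allZn n (suc d) ] excess x x′)
    ≡⟨ cong (Γ *_) (∑-swap (allZn n (suc d)) (divisors n) _) ⟩
  Γ * (∑[ g ∈ divisors n ] ∑[ x′ ∈ allZn n (suc d) ] 𝟙 (2 ≤? g) * (g * congruent g x x′))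
    ≡⟨ sym (∑-*ˡ (divisors n) Γ _) ⟩
  (∑[ g ∈ divisors n ] Γ * (∑[ x′ ∈ allZn n (suc d) ] 𝟙 (2 ≤? g) * (g * congruent g x x′)))
    ≤⟨ (∑-mono-∈ (divisors n) λ g g∈ → term g (proj₂ (∈-filter⁻ (λ m → m ∣? n) {xs = L.map suc (upTo n)} g∈)) (2 ≤? g)) ⟩
  (∑[ g ∈ divisors n ] n ^ suc d)
    ≡⟨ ∑-const (divisors n) (n ^ suc d) ⟩
  τ n * n ^ suc d ∎
  where
  open ≤-Reasoning
  Γ = γ n ^ d
  term : ∀ g → g ∣ n → (p : Dec (2 ≤ g)) → Γ * (∑[ x′ ∈ allZn n (suc d) ] 𝟙 p * (g * congruent g x x′)) ≤ n ^ suc d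
  term g g∣n (no _) = ≤-trans (≤-reflexive (trans (cong (Γ *_) (∑-zero (allZn n (suc d)))) (*-zeroʳ Γ))) z≤n
  term g g∣n (yes 2≤g) = begin
    Γ * (∑[ x′ ∈ allZn n (suc d) ] 1 * (g * congruent g x x′))
      ≡⟨ cong (Γ *_) (trans (∑-*ˡ (allZn n (suc d)) 1 _) (trans (*-identityˡ _) (∑-*ˡ (allZn n (suc d)) g _))) ⟩
    Γ * (g * congruents)
      -- Here `d` is one less than the dimension. From `γ n ≤ g` comes `g ^ d`, and the weight `g`
      -- supplies the missing power for `count-congruent`.
      ≤⟨ *-monoˡ-≤ (g * congruents) (^-monoˡ-≤ d (γ-≤-divisor 2≤g g∣n)) ⟩
    g ^ d * (g * congruents)
      ≡⟨ arrange (g ^ d) g congruents ⟩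
    g ^ suc d * congruents
      ≤⟨ count-congruent x g∣n ⟩
    n ^ suc d ∎
    where
    congruents = ∑[ x′ ∈ allZn n (suc d) ] congruent g x x′
    arrange : ∀ a b c → a * (b * c) ≡ b * a * c
    arrange = solve-∀

-- Energy of a star

-- Truncated subtraction gives the square of the difference only in one order, so the other order is
-- obtained by symmetry.
2ab≤a²+b² : ∀ a b → 2 * (a * b) ≤ a * a + b * b
2ab≤a²+b² a b = case (≤-total a b)
  where
  square : ∀ a r → 2 * (a * (a + r)) + r * r ≡ a * a + (a + r) * (a + r)
  square = solve-∀
  ordered : ∀ {a b} → a ≤ b → 2 * (a * b) ≤ a * a + b * b
  ordered {a} {b} a≤b = subst (λ b → 2 * (a * b) ≤ a * a + b * b) (m+[n∸m]≡n a≤b)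
    (≤-trans (m≤m+n _ ((b ∸ a) * (b ∸ a))) (≤-reflexive (square a (b ∸ a))))
  case : a ≤ b ⊎ b ≤ a → 2 * (a * b) ≤ a * a + b * b
  case (inj₁ a≤b) = ordered a≤b
  case (inj₂ b≤a) = subst₂ _≤_ (cong (2 *_) (*-comm b a)) (+-comm (b * b) (a * a)) (ordered b≤a)

-- Sum `2 * (f x * f y) ≤ f x * f x + f y * f y` over all pairs.
cauchy-schwarz : (xs : List A) (f : A → ℕ) → ∑ xs f * ∑ xs f ≤ length xs * (∑[ x ∈ xs ] f x * f x)
cauchy-schwarz xs f = *-cancelˡ-≤ 2 (begin
  2 * (∑ xs f * ∑ xs f)
    ≡⟨ cong (2 *_) (∑-*-∑ xs xs f f) ⟩
  2 * (∑[ x ∈ xs ] ∑[ y ∈ xs ] f x * f y)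
    ≡⟨ trans (sym (∑-*ˡ xs 2 _)) (∑-cong xs λ x → sym (∑-*ˡ xs 2 _)) ⟩
  (∑[ x ∈ xs ] ∑[ y ∈ xs ] 2 * (f x * f y))
    ≤⟨ (∑-mono xs λ x → ∑-mono xs λ y → 2ab≤a²+b² (f x) (f y)) ⟩
  (∑[ x ∈ xs ] ∑[ y ∈ xs ] (f x * f x + f y * f y))
    ≡⟨ (∑-cong xs λ x → trans (∑-+ xs _ _) (cong (λ z → z + squares) (∑-const xs (f x * f x)))) ⟩
  (∑[ x ∈ xs ] (length xs * (f x * f x) + squares))
    ≡⟨ trans (∑-+ xs _ _) (cong₂ _+_ (∑-*ˡ xs (length xs) _) (∑-const xs squares)) ⟩
  length xs * squares + length xs * squares
    ≡⟨ double (length xs * squares) ⟩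
  2 * (length xs * squares) ∎)
  where
  open ≤-Reasoning
  squares = ∑[ x ∈ xs ] f x * f x
  double : ∀ a → a + a ≡ 2 * a
  double = solve-∀

-- Applied to the Boolean test in `starCard`: a tuple either passes it or has an empty fibre.
any-or-none : {R : A → Set} (R? : Decidable R) (xs : List A) →
              T (any (λ x → ⌊ R? x ⌋) xs) ⊎ ∑ xs (λ x → 𝟙 (R? x)) ≡ 0
any-or-none R? [] = inj₂ refl
any-or-none R? (x ∷ xs) with R? x
... | yes _ = inj₁ _
... | no _  = any-or-none R? xs

module Energy {n d : ℕ} .{{_ : NonZero n}} (E : Subset n d) where

  N : ℕ
  N = card E

  ν : {k : ℕ} → Vec (Zn^ n d) k → Zn^ n k → ℕ
  ν ys t = ∑[ x ∈ elems E ] 𝟙 (starTuple ys x ≟V t)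

  energy : {k : ℕ} → Vec (Zn^ n d) k → ℕ
  energy {k} ys = ∑[ t ∈ allZn n k ] ν ys t * ν ys t

  agree : {k : ℕ} → Vec (Zn^ n d) k → Zn^ n d → Zn^ n d → ℕ
  agree ys x x′ = 𝟙 (starTuple ys x ≟V starTuple ys x′)

  ∑-ν : ∀ {k} (ys : Vec (Zn^ n d) k) → (∑[ t ∈ allZn n k ] ν ys t) ≡ N
  ∑-ν {k} ys = trans (∑-swap (allZn n k) (elems E) _)
    (trans (∑-cong (elems E) λ x → trans (∑-cong (allZn n k) λ t → sym (*-identityʳ _)) (∑-allZn-𝟙 (starTuple ys x) (λ _ → 1)))
           (sym (length-as-∑ (elems E))))

  -- Expanding the squares and summing over `t` first leaves only the tuple of `x′`. Thus the energy
  -- counts the pairs that `ys` does not separate.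
  energy-pairs : ∀ {k} (ys : Vec (Zn^ n d) k) → energy ys ≡ (∑[ x ∈ elems E ] ∑[ x′ ∈ elems E ] agree ys x x′)
  energy-pairs {k} ys =
    trans (∑-cong (allZn n k) λ t → ∑-*-∑ (elems E) (elems E) _ _)
    (trans (∑-swap (allZn n k) (elems E) _) (∑-cong (elems E) λ x →
    trans (∑-swap (allZn n k) (elems E) _) (∑-cong (elems E) λ x′ →
    trans (∑-cong (allZn n k) λ t → *-comm (𝟙 (starTuple ys x ≟V t)) _)
          (∑-allZn-𝟙 (starTuple ys x′) (λ t → 𝟙 (starTuple ys x ≟V t))))))

  ν-refine : ∀ {k} (y : Zn^ n d) (ys : Vec (Zn^ n d) k) t → ν ys t ≡ (∑[ j ∈ allFin n ] ν (y ∷ ys) (j ∷ t))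
  ν-refine y ys t = sym (trans (∑-swap (allFin n) (elems E) _) (∑-cong (elems E) λ x →
    trans (∑-cong (allFin n) λ j → 𝟙-∷ (sqDist x y) j (starTuple ys x) t)
          (∑-allFin-𝟙 {i = sqDist x y} (λ _ → 𝟙 (starTuple ys x ≟V t)))))

  -- The fibre over `t` splits into `n` fibres according to the distance to `y`, and Cauchy-Schwarz
  -- applies to each such splitting.
  energy-refine : ∀ {k} (y : Zn^ n d) (ys : Vec (Zn^ n d) k) → energy ys ≤ n * energy (y ∷ ys)
  energy-refine {k} y ys = begin
    energy ys
      ≡⟨ (∑-cong (allZn n k) λ t → cong₂ _*_ (ν-refine y ys t) (ν-refine y ys t)) ⟩
    (∑[ t ∈ allZn n k ] (∑[ j ∈ allFin n ] ν (y ∷ ys) (j ∷ t)) * (∑[ j ∈ allFin n ] ν (y ∷ ys) (j ∷ t)))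
      ≤⟨ (∑-mono (allZn n k) λ t → cauchy-schwarz (allFin n) (λ j → ν (y ∷ ys) (j ∷ t))) ⟩
    (∑[ t ∈ allZn n k ] length (allFin n) * (∑[ j ∈ allFin n ] ν (y ∷ ys) (j ∷ t) * ν (y ∷ ys) (j ∷ t)))
      ≡⟨ ∑-*ˡ (allZn n k) (length (allFin n)) _ ⟩
    length (allFin n) * (∑[ t ∈ allZn n k ] ∑[ j ∈ allFin n ] ν (y ∷ ys) (j ∷ t) * ν (y ∷ ys) (j ∷ t))
      ≡⟨ cong₂ _*_ (L.length-tabulate {n = n} id)
           (trans (∑-swap (allZn n k) (allFin n) _) (sym (∑-allVecsOf (allFin n) k _))) ⟩
    n * energy (y ∷ ys) ∎
    where open ≤-Reasoning

  totalExcess : ℕ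
  totalExcess = ∑[ x ∈ elems E ] ∑[ x′ ∈ elems E ] excess x x′

  -- Only the inner sum is extended from `E` to the whole space. The outer one contributes the
  -- factor `N`.
  totalExcess-bound : 1 ≤ d → γ n ^ (d ∸ 1) * totalExcess ≤ N * (τ n * n ^ d)
  totalExcess-bound 1≤d = begin
    Γ * totalExcess
      ≡⟨ sym (∑-*ˡ (elems E) Γ _) ⟩
    (∑[ x ∈ elems E ] Γ * (∑[ x′ ∈ elems E ] excess x x′))
      ≤⟨ (∑-mono (elems E) λ x → ≤-trans (*-monoʳ-≤ Γ (∑-filter-≤ (λ x → T? (E x)) (allZn n d) _)) (excess-average 1≤d x)) ⟩
    (∑[ x ∈ elems E ] τ n * n ^ d)
      ≡⟨ ∑-const (elems E) _ ⟩
    N * (τ n * n ^ d) ∎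
    where
    open ≤-Reasoning
    Γ = γ n ^ (d ∸ 1)

  -- A pair agrees on `y ∷ ys` exactly when it agrees on `ys` and `y` is equidistant from its two
  -- points. Summing over every `y` brings in `count-equidistant`.
  energy-all-apices : n % 2 ≡ 1 → ∀ {k} (ys : Vec (Zn^ n d) k) →
                      (∑[ y ∈ allZn n d ] n * energy (y ∷ ys)) ≤ n ^ d * (energy ys + totalExcess)
  energy-all-apices odd ys = begin
    (∑[ y ∈ allZn n d ] n * energy (y ∷ ys))
      ≡⟨ ∑-*ˡ (allZn n d) n _ ⟩
    n * (∑[ y ∈ allZn n d ] energy (y ∷ ys))
      ≡⟨ cong (n *_) regroup ⟩
    n * (∑[ x ∈ elems E ] ∑[ x′ ∈ elems E ] equidistant x x′ * agree ys x x′)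
      ≡⟨ trans (sym (∑-*ˡ (elems E) n _)) (∑-cong (elems E) λ x → sym (∑-*ˡ (elems E) n _)) ⟩
    (∑[ x ∈ elems E ] ∑[ x′ ∈ elems E ] n * (equidistant x x′ * agree ys x x′))
      ≤⟨ (∑-mono (elems E) λ x → ∑-mono (elems E) λ x′ → pointwise x x′) ⟩
    (∑[ x ∈ elems E ] ∑[ x′ ∈ elems E ] n ^ d * (agree ys x x′ + excess x x′))
      ≡⟨ trans (∑-cong (elems E) λ x → ∑-*ˡ (elems E) (n ^ d) _) (∑-*ˡ (elems E) (n ^ d) _) ⟩
    n ^ d * (∑[ x ∈ elems E ] ∑[ x′ ∈ elems E ] (agree ys x x′ + excess x x′))
      ≡⟨ cong (n ^ d *_) (trans (∑-cong (elems E) λ x → ∑-+ (elems E) _ _) (∑-+ (elems E) _ _)) ⟩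
    n ^ d * ((∑[ x ∈ elems E ] ∑[ x′ ∈ elems E ] agree ys x x′) + totalExcess)
      ≡⟨ cong (λ z → n ^ d * (z + totalExcess)) (sym (energy-pairs ys)) ⟩
    n ^ d * (energy ys + totalExcess) ∎
    where
    open ≤-Reasoning
    equidistant : Zn^ n d → Zn^ n d → ℕ
    equidistant x x′ = ∑[ y ∈ allZn n d ] 𝟙 (sqDist x y ≟F sqDist x′ y)
    regroup : (∑[ y ∈ allZn n d ] energy (y ∷ ys)) ≡ (∑[ x ∈ elems E ] ∑[ x′ ∈ elems E ] equidistant x x′ * agree ys x x′)
    regroup = trans (∑-cong (allZn n d) λ y → energy-pairs (y ∷ ys))
      (trans (∑-swap (allZn n d) (elems E) _) (∑-cong (elems E) λ x →
       trans (∑-swap (allZn n d) (elems E) _) (∑-cong (elems E) λ x′ →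
       trans (∑-cong (allZn n d) λ y → 𝟙-∷ (sqDist x y) (sqDist x′ y) (starTuple ys x) (starTuple ys x′))
             (∑-*ʳ (allZn n d) (agree ys x x′) _))))
    -- The agreement is kept in the main term and dropped from the excess, which makes the error
    -- independent of `ys`.
    weaken : ∀ a → a ≤ 1 → ∀ c → (1 + c) * a ≤ a + c
    weaken a a≤1 c = +-monoʳ-≤ a (≤-trans (*-monoʳ-≤ c a≤1) (≤-reflexive (*-identityʳ c)))
    𝟙≤1 : (p : Dec P) → 𝟙 p ≤ 1
    𝟙≤1 (yes _) = ≤-refl
    𝟙≤1 (no _)  = z≤n
    pointwise : ∀ x x′ → n * (equidistant x x′ * agree ys x x′) ≤ n ^ d * (agree ys x x′ + excess x x′)
    pointwise x x′ = begin
      n * (equidistant x x′ * agree ys x x′)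
        ≡⟨ sym (*-assoc n _ _) ⟩
      n * equidistant x x′ * agree ys x x′
        ≤⟨ *-monoˡ-≤ (agree ys x x′) (≤-trans (count-equidistant odd x x′) (*-monoʳ-≤ (n ^ d) (content≤1+excess x x′))) ⟩
      n ^ d * (1 + excess x x′) * agree ys x x′
        ≡⟨ *-assoc (n ^ d) _ _ ⟩
      n ^ d * ((1 + excess x x′) * agree ys x x′)
        ≤⟨ *-monoʳ-≤ (n ^ d) (weaken (agree ys x x′) (𝟙≤1 (starTuple ys x ≟V starTuple ys x′)) (excess x x′)) ⟩
      n ^ d * (agree ys x x′ + excess x x′) ∎

  -- The gain n * energy (y ∷ ys) - energy ys is nonnegative, so its sum over y ∈ E is at most its sum over all y.
  energy-apices : n % 2 ≡ 1 → ∀ {k} (ys : Vec (Zn^ n d) k) →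
                  (∑[ y ∈ elems E ] n * energy (y ∷ ys)) ≤ N * energy ys + n ^ d * totalExcess
  energy-apices odd ys = begin
    (∑[ y ∈ elems E ] n * energy (y ∷ ys))
      ≡⟨ split (elems E) ⟩
    N * energy ys + ∑ (elems E) gain
      ≤⟨ +-monoʳ-≤ (N * energy ys) (≤-trans (∑-filter-≤ (λ x → T? (E x)) (allZn n d) gain) total-gain) ⟩
    N * energy ys + n ^ d * totalExcess ∎
    where
    open ≤-Reasoning
    -- `energy-refine` makes this truncated difference exact.
    gain : Zn^ n d → ℕ
    gain y = n * energy (y ∷ ys) ∸ energy ys
    split : ∀ Y → (∑[ y ∈ Y ] n * energy (y ∷ ys)) ≡ length Y * energy ys + ∑ Y gain
    split Y = trans (∑-cong Y λ y → sym (m+[n∸m]≡n (energy-refine y ys)))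
      (trans (∑-+ Y _ _) (cong (λ z → z + ∑ Y gain) (∑-const Y (energy ys))))
    -- Over all `n ^ d` apices the main terms add up to `n ^ d * energy ys`, which cancels against
    -- the same term in `energy-all-apices`.
    total-gain : ∑ (allZn n d) gain ≤ n ^ d * totalExcess
    total-gain = +-cancelˡ-≤ (n ^ d * energy ys) _ _ (begin
      n ^ d * energy ys + ∑ (allZn n d) gain
        ≡⟨ cong (λ z → z * energy ys + ∑ (allZn n d) gain) (sym (length-allZn n d)) ⟩
      length (allZn n d) * energy ys + ∑ (allZn n d) gain
        ≡⟨ sym (split (allZn n d)) ⟩
      (∑[ y ∈ allZn n d ] n * energy (y ∷ ys))
        ≤⟨ energy-all-apices odd ys ⟩
      n ^ d * (energy ys + totalExcess)
        ≡⟨ *-distribˡ-+ (n ^ d) (energy ys) totalExcess ⟩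
      n ^ d * energy ys + n ^ d * totalExcess ∎)

  -- Total energy over all tuples of apices

  totalEnergy : ℕ → ℕ
  totalEnergy k = ∑ (allVecsOf (elems E) k) energy

  -- The empty tuple of apices has a single fibre, all of `E`.
  totalEnergy-zero : totalEnergy 0 ≡ N * N
  totalEnergy-zero = trans (+-identityʳ _) (trans (+-identityʳ _) (cong₂ _*_ ν[]≡N ν[]≡N))
    where
    ν[]≡N : ν [] [] ≡ N
    ν[]≡N = trans (sym (+-identityʳ _)) (∑-ν [])

  -- `energy-apices` is summed over the `N ^ k` tuples `ys`, each with the same error.
  totalEnergy-suc : n % 2 ≡ 1 → ∀ k → n * totalEnergy (suc k) ≤ N * totalEnergy k + N ^ k * (n ^ d * totalExcess)
  totalEnergy-suc odd k = begin
    n * totalEnergy (suc k)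
      ≡⟨ trans (sym (∑-*ˡ (allVecsOf (elems E) (suc k)) n energy)) (∑-allVecsOf (elems E) k _) ⟩
    (∑[ y ∈ elems E ] ∑[ ys ∈ allVecsOf (elems E) k ] n * energy (y ∷ ys))
      ≡⟨ ∑-swap (elems E) (allVecsOf (elems E) k) _ ⟩
    (∑[ ys ∈ allVecsOf (elems E) k ] ∑[ y ∈ elems E ] n * energy (y ∷ ys))
      ≤⟨ (∑-mono (allVecsOf (elems E) k) λ ys → energy-apices odd ys) ⟩
    (∑[ ys ∈ allVecsOf (elems E) k ] (N * energy ys + n ^ d * totalExcess))
      ≡⟨ trans (∑-+ (allVecsOf (elems E) k) _ _) (cong₂ _+_ (∑-*ˡ (allVecsOf (elems E) k) N energy)
           (trans (∑-const (allVecsOf (elems E) k) _) (cong (_* (n ^ d * totalExcess)) (length-allVecsOf (elems E) k)))) ⟩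
    N * totalEnergy k + N ^ k * (n ^ d * totalExcess) ∎
    where open ≤-Reasoning

  totalEnergy-bound : n % 2 ≡ 1 → 1 ≤ d → ∀ k → let Γ = γ n ^ (d ∸ 1) in
    n ^ suc k * (Γ * totalEnergy k) ≤ n * Γ * N ^ (2 + k) + k * (n ^ (2 * d + k) * (τ n * N ^ k))
  totalEnergy-bound odd 1≤d zero = ≤-reflexive (trans (cong (λ z → n ^ 1 * (Γ * z)) totalEnergy-zero) (rearrange n Γ N))
    where
    Γ = γ n ^ (d ∸ 1)
    rearrange : ∀ n Γ N → n * 1 * (Γ * (N * N)) ≡ n * Γ * (N * (N * 1)) + 0
    rearrange = solve-∀
  totalEnergy-bound odd 1≤d (suc k) = begin
    n * p * (Γ * totalEnergy (suc k))
      ≡⟨ step₁ n p Γ (totalEnergy (suc k)) ⟩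
    p * (Γ * (n * totalEnergy (suc k)))
      ≤⟨ *-monoʳ-≤ p (*-monoʳ-≤ Γ (totalEnergy-suc odd k)) ⟩
    p * (Γ * (N * totalEnergy k + N ^ k * (n ^ d * totalExcess)))
      ≡⟨ step₂ p Γ N (totalEnergy k) (N ^ k) (n ^ d) totalExcess ⟩
    N * (p * (Γ * totalEnergy k)) + p * (N ^ k * (n ^ d * (Γ * totalExcess)))
      ≤⟨ +-mono-≤ (*-monoʳ-≤ N (totalEnergy-bound odd 1≤d k))
           (*-monoʳ-≤ p (*-monoʳ-≤ (N ^ k) (*-monoʳ-≤ (n ^ d) (totalExcess-bound 1≤d)))) ⟩
    N * (n * Γ * N ^ (2 + k) + k * (n ^ (2 * d + k) * (τ n * N ^ k))) + p * (N ^ k * (n ^ d * (N * (τ n * n ^ d))))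
      ≡⟨ cong (λ z → N * (n * Γ * N ^ (2 + k) + k * (z * (τ n * N ^ k))) + p * (N ^ k * (n ^ d * (N * (τ n * n ^ d))))) n^[2d+k] ⟩
    N * (n * Γ * N ^ (2 + k) + k * (n ^ d * n ^ d * n ^ k * (τ n * N ^ k))) + p * (N ^ k * (n ^ d * (N * (τ n * n ^ d))))
      ≡⟨ step₃ N n Γ (N ^ k) k (n ^ d) (n ^ k) (τ n) ⟩
    n * Γ * N ^ (3 + k) + (k * (n ^ d * n ^ d * n ^ k * (τ n * (N * N ^ k))) + n * (n ^ d * n ^ d * n ^ k * (τ n * (N * N ^ k))))
      -- Each of the `k` earlier errors is now smaller than the new one by a factor `n`. That factor
      -- is given away so that all the errors have the same size.
      ≤⟨ +-monoʳ-≤ (n * Γ * N ^ (3 + k)) (+-monoˡ-≤ (n * W) (*-monoʳ-≤ k (m≤n*m W n))) ⟩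
    n * Γ * N ^ (3 + k) + (k * (n * W) + n * W)
      ≡⟨ cong (_+_ (n * Γ * N ^ (3 + k))) (trans (step₄ k n (n ^ d * n ^ d * n ^ k) (τ n * (N * N ^ k)))
           (cong (λ z → suc k * (z * (τ n * N ^ suc k))) (sym (trans (cong (n ^_) (+-suc (2 * d) k)) (cong (n *_) n^[2d+k]))))) ⟩
    n * Γ * N ^ (3 + k) + suc k * (n ^ (2 * d + suc k) * (τ n * N ^ suc k)) ∎
    where
    open ≤-Reasoning
    Γ = γ n ^ (d ∸ 1)
    p = n ^ suc k
    W = n ^ d * n ^ d * n ^ k * (τ n * (N * N ^ k))
    n^[2d+k] : n ^ (2 * d + k) ≡ n ^ d * n ^ d * n ^ k
    n^[2d+k] = trans (^-distribˡ-+-* n (2 * d) k) (cong (_* n ^ k)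
      (trans (cong (λ z → n ^ (d + z)) (+-identityʳ d)) (^-distribˡ-+-* n d d)))
    step₁ : ∀ n p Γ T → n * p * (Γ * T) ≡ p * (Γ * (n * T))
    step₁ = solve-∀
    step₂ : ∀ p Γ N T q r S → p * (Γ * (N * T + q * (r * S))) ≡ N * (p * (Γ * T)) + p * (q * (r * (Γ * S)))
    step₂ = solve-∀
    step₃ : ∀ N n Γ q k r s t →
      N * (n * Γ * (N * (N * q)) + k * (r * r * s * (t * q))) + n * s * (q * (r * (N * (t * r)))) ≡
      n * Γ * (N * (N * (N * q))) + (k * (r * r * s * (t * (N * q))) + n * (r * r * s * (t * (N * q))))
    step₃ = solve-∀
    step₄ : ∀ k n r t → k * (n * (r * t)) + n * (r * t) ≡ suc k * (n * r * t)
    step₄ = solve-∀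

  -- Summing (2N − n^k ν(t))² ≥ 0 over the attained t.
  starCard-energy : ∀ {k} (ys : Vec (Zn^ n d) k) →
                    2 * (2 * N * (n ^ k * N)) ≤ 2 * N * (2 * N) * starCard E ys + n ^ k * n ^ k * energy ys
  starCard-energy {k} ys = begin
    2 * (2 * N * (n ^ k * N))
      ≡⟨ cong (λ z → 2 * (2 * N * (n ^ k * z))) (sym (∑-ν ys)) ⟩
    2 * (2 * N * (n ^ k * (∑[ t ∈ allZn n k ] ν ys t)))
      ≡⟨ sym (trans (∑-*ˡ (allZn n k) 2 _) (cong (2 *_) (trans (∑-*ˡ (allZn n k) (2 * N) _) (cong (2 * N *_) (∑-*ˡ (allZn n k) (n ^ k) _))))) ⟩
    (∑[ t ∈ allZn n k ] 2 * (2 * N * (n ^ k * ν ys t)))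
      ≤⟨ ∑-mono (allZn n k) pointwise ⟩
    (∑[ t ∈ allZn n k ] (2 * N * (2 * N) * 𝟙 (attained? t) + n ^ k * n ^ k * (ν ys t * ν ys t)))
      ≡⟨ trans (∑-+ (allZn n k) _ _) (cong₂ _+_ (∑-*ˡ (allZn n k) (2 * N * (2 * N)) _) (∑-*ˡ (allZn n k) (n ^ k * n ^ k) _)) ⟩
    2 * N * (2 * N) * (∑[ t ∈ allZn n k ] 𝟙 (attained? t)) + n ^ k * n ^ k * energy ys
      ≡⟨ cong (λ z → 2 * N * (2 * N) * z + n ^ k * n ^ k * energy ys) (sym (length-filter-∑ attained? (allZn n k))) ⟩
    2 * N * (2 * N) * starCard E ys + n ^ k * n ^ k * energy ys ∎
    where
    open ≤-Reasoning
    attained? : ∀ t → Dec (T (any (λ x → ⌊ starTuple ys x ≟V t ⌋) (elems E)))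
    attained? t = T? (any (λ x → ⌊ starTuple ys x ≟V t ⌋) (elems E))
    swap-square : ∀ a b → a * b * (a * b) ≡ a * a * (b * b)
    swap-square = solve-∀
    pointwise : ∀ t → 2 * (2 * N * (n ^ k * ν ys t)) ≤ 2 * N * (2 * N) * 𝟙 (attained? t) + n ^ k * n ^ k * (ν ys t * ν ys t)
    pointwise t with any-or-none (λ x → starTuple ys x ≟V t) (elems E)
    ... | inj₁ attained = ≤-trans (2ab≤a²+b² (2 * N) (n ^ k * ν ys t)) (≤-reflexive (cong₂ _+_
            (trans (sym (*-identityʳ _)) (cong (2 * N * (2 * N) *_) (sym (𝟙-yes (attained? t) attained))))
            (swap-square (n ^ k) (ν ys t))))
    -- An unattained `t` contributes nothing on the left, so the constant term is charged only to
    -- attained tuples. This is what produces `starCard`.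
    ... | inj₂ ν≡0 = ≤-trans (≤-reflexive (trans (cong (λ z → 2 * (2 * N * (n ^ k * z))) ν≡0) (vanish N (n ^ k)))) z≤n
      where
      vanish : ∀ N a → 2 * (2 * N * (a * 0)) ≡ 0
      vanish = solve-∀

  starSum-energy : ∀ k → N ^ k * (2 * (2 * N * (n ^ k * N))) ≤ 2 * N * (2 * N) * starSum k E + n ^ k * n ^ k * totalEnergy k
  starSum-energy k = begin
    N ^ k * c
      ≡⟨ trans (cong (_* c) (sym (length-allVecsOf (elems E) k))) (sym (∑-const (allVecsOf (elems E) k) c)) ⟩
    (∑[ ys ∈ allVecsOf (elems E) k ] c)
      ≤⟨ ∑-mono (allVecsOf (elems E) k) starCard-energy ⟩
    (∑[ ys ∈ allVecsOf (elems E) k ] (2 * N * (2 * N) * starCard E ys + n ^ k * n ^ k * energy ys))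
      ≡⟨ trans (∑-+ (allVecsOf (elems E) k) _ _) (cong₂ _+_ (∑-*ˡ (allVecsOf (elems E) k) (2 * N * (2 * N)) _)
           (∑-*ˡ (allVecsOf (elems E) k) (n ^ k * n ^ k) _)) ⟩
    2 * N * (2 * N) * starSum k E + n ^ k * n ^ k * totalEnergy k ∎
    where
    open ≤-Reasoning
    c = 2 * (2 * N * (n ^ k * N))

-- The lower bound on `card E` is squared to remove roots and half-integer exponents, so `C` is the
-- square of the constant in the hypothesis. The average is multiplied by its denominator, and 1/m
-- is the constant in the conclusion. Both are chosen before `n` and `E`.
theorem4p1 : (d k : ℕ) → 1 ≤ d → 1 ≤ k →
    Σ ℕ λ C → Σ ℕ λ m → 1 ≤ m ×
    ((n : ℕ) .{{_ : NonZero n}} → 3 ≤ n → n % 2 ≡ 1 → (E : Subset n d) →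
    C * τ n * n ^ (2 * d + k ∸ 1) ≤ card E ^ 2 * γ n ^ (d ∸ 1) →
    n ^ k * card E ^ k ≤ m * starSum k E)
-- `C = k` absorbs the `k` errors, one per apex, into the main term. With the total energy at most
-- twice its main term, the weight `2 * N` in `starCard-energy` leaves half of `n ^ k * N ^ k`,
-- hence `m = 2`. This weight is optimal for that energy bound.
theorem4p1 d k 1≤d 1≤k = k , 2 , s≤s z≤n , λ n 3≤n odd E large → proof n odd E large
  where
  proof : (n : ℕ) .{{_ : NonZero n}} → n % 2 ≡ 1 → (E : Subset n d) →
          k * τ n * n ^ (2 * d + k ∸ 1) ≤ card E ^ 2 * γ n ^ (d ∸ 1) →
          n ^ k * card E ^ k ≤ 2 * starSum k E
  -- The bound for the energy term is added to both sides in place of a subtraction.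
  proof n odd E large = *-cancelˡ-≤ (2 * (N * N)) {{m*n≢0 2 (N * N) {{_}} {{m*n≢0 N N}}}}
    (+-cancelʳ-≤ (2 * (n ^ k * N ^ (2 + k))) _ _ (begin
      2 * (N * N) * (n ^ k * N ^ k) + 2 * (n ^ k * N ^ (2 + k))
        ≡⟨ step₃ N (n ^ k) (N ^ k) ⟩
      N ^ k * (2 * (2 * N * (n ^ k * N)))
        ≤⟨ starSum-energy k ⟩
      2 * N * (2 * N) * starSum k E + n ^ k * n ^ k * totalEnergy k
        ≡⟨ cong (_+_ (2 * N * (2 * N) * starSum k E)) (*-assoc (n ^ k) (n ^ k) (totalEnergy k)) ⟩
      2 * N * (2 * N) * starSum k E + n ^ k * (n ^ k * totalEnergy k)
        ≤⟨ +-monoʳ-≤ (2 * N * (2 * N) * starSum k E) (*-monoʳ-≤ (n ^ k) energy≤) ⟩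
      2 * N * (2 * N) * starSum k E + n ^ k * (2 * N ^ (2 + k))
        ≡⟨ step₄ N (starSum k E) (n ^ k) (N ^ (2 + k)) ⟩
      2 * (N * N) * (2 * starSum k E) + 2 * (n ^ k * N ^ (2 + k)) ∎))
    where
    open ≤-Reasoning
    open Energy E
    Γ = γ n ^ (d ∸ 1)
    instance
      -- That `E` is nonempty comes from the size hypothesis: its left side is positive, hence so is
      -- its right side.
      lhs≢0 : NonZero (k * τ n * n ^ (2 * d + k ∸ 1))
      lhs≢0 = m*n≢0 (k * τ n) _ {{m*n≢0 k (τ n) {{>-nonZero 1≤k}} {{τ-nonZero n}}}} {{m^n≢0 n (2 * d + k ∸ 1)}}
      rhs≢0 : NonZero (N ^ 2 * Γ)
      rhs≢0 = >-nonZero (≤-trans (>-nonZero⁻¹ (k * τ n * n ^ (2 * d + k ∸ 1))) large)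
      N≢0 : NonZero N
      N≢0 = m*n≢0⇒m≢0 N {{m*n≢0⇒m≢0 (N ^ 2) {{rhs≢0}}}}
      Γ≢0 : NonZero Γ
      Γ≢0 = m*n≢0⇒n≢0 (N ^ 2) {{rhs≢0}}
    -- The size hypothesis multiplied by `n * N ^ k`. The subtraction in its exponent is exact
    -- because `k ≥ 1`.
    remainder≤ : k * (n ^ (2 * d + k) * (τ n * N ^ k)) ≤ n * Γ * N ^ (2 + k)
    remainder≤ = begin
      k * (n ^ (2 * d + k) * (τ n * N ^ k))
        ≡⟨ cong (λ z → k * (n ^ z * (τ n * N ^ k))) (sym (m+[n∸m]≡n {1} {2 * d + k} (≤-trans 1≤k (m≤n+m k (2 * d))))) ⟩
      k * (n * n ^ (2 * d + k ∸ 1) * (τ n * N ^ k))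
        ≡⟨ step₁ k n (n ^ (2 * d + k ∸ 1)) (τ n) (N ^ k) ⟩
      k * τ n * n ^ (2 * d + k ∸ 1) * (n * N ^ k)
        ≤⟨ *-monoˡ-≤ (n * N ^ k) large ⟩
      N ^ 2 * Γ * (n * N ^ k)
        ≡⟨ step₂ N Γ n (N ^ k) ⟩
      n * Γ * N ^ (2 + k) ∎
      where
      step₁ : ∀ k n p t q → k * (n * p * (t * q)) ≡ k * t * p * (n * q)
      step₁ = solve-∀
      step₂ : ∀ N Γ n q → N * (N * 1) * Γ * (n * q) ≡ n * Γ * (N * (N * q))
      step₂ = solve-∀
    -- The main term and the remainder are each at most `n * Γ * N ^ (2 + k)`, which gives the
    -- factor `2`.
    energy≤ : n ^ k * totalEnergy k ≤ 2 * N ^ (2 + k)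
    energy≤ = *-cancelˡ-≤ (n * Γ) {{m*n≢0 n Γ}} (begin
      n * Γ * (n ^ k * totalEnergy k)
        ≡⟨ step₁ n Γ (n ^ k) (totalEnergy k) ⟩
      n ^ suc k * (Γ * totalEnergy k)
        ≤⟨ totalEnergy-bound odd 1≤d k ⟩
      n * Γ * N ^ (2 + k) + k * (n ^ (2 * d + k) * (τ n * N ^ k))
        ≤⟨ +-monoʳ-≤ (n * Γ * N ^ (2 + k)) remainder≤ ⟩
      n * Γ * N ^ (2 + k) + n * Γ * N ^ (2 + k)
        ≡⟨ step₂ (n * Γ) (N ^ (2 + k)) ⟩
      n * Γ * (2 * N ^ (2 + k)) ∎)
      where
      step₁ : ∀ n Γ p T → n * Γ * (p * T) ≡ n * p * (Γ * T)
      step₁ = solve-∀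
      step₂ : ∀ a b → a * b + a * b ≡ a * (2 * b)
      step₂ = solve-∀
    step₃ : ∀ N p q → 2 * (N * N) * (p * q) + 2 * (p * (N * (N * q))) ≡ q * (2 * (2 * N * (p * N)))
    step₃ = solve-∀
    step₄ : ∀ N s p r → 2 * N * (2 * N) * s + p * (2 * r) ≡ 2 * (N * N) * (2 * s) + 2 * (p * r)
    step₄ = solve-∀
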